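{- The variance of the `number of jumps' statistic $J$ among all full binary trees with $n$ internal vertices (each such tree being equally likely) is $$ \frac{n^{2}-1}{8 n -4}. $$
   Context: A full binary tree is an unlabeled ordered tree defined recursively: it is either the single-vertex tree, denoted $\cdot$, or a pair $T=[T_L,T_R]$ where $T_L$ (left subtree) and $T_R$ (right subtree) are full binary trees. The number of internal vertices $V(T)$ is defined by $V(\cdot)=0$, $V([T_L,T_R])=V(T_L)+V(T_R)+1$. The number of jumps $J(T)$ is defined by $J(\cdot)=0$ and $J([T_L,T_R])=J(T_R)$ if $T_L=\cdot$, while $J([T_L,T_R])=J(T_L)+J(T_R)+1$ if $T_L\neq \cdot$.
   Formalization: The number n of internal vertices is assumed to be at least 1; for n = 0 the only tree is the single vertex, the variance is 0, and the stated formula would give 1/4. -}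

module Defs where

open import Data.List.Base using (List; []; _∷_; length; map; foldr; filter; cartesianProductWith)
open import Data.List.Membership.Propositional using (_∈_)
open import Data.List.Membership.Propositional.Properties
  using (∈-cartesianProductWith⁺; ∈-cartesianProductWith⁻; ∈-filter⁺; ∈-filter⁻)
open import Data.List.Relation.Unary.All as All using ()
open import Data.List.Relation.Unary.AllPairs using ([]; _∷_)
open import Data.List.Relation.Unary.Any using (here; there)
open import Data.List.Relation.Unary.Unique.Propositional using (Unique)
import Data.List.Relation.Unary.Unique.Propositional.Properties as Unique
open import Data.Integer.Base using (+_)
open import Data.Nat.Base using (ℕ; zero; suc; _+_; _*_; _∸_; _≤_; s≤s⁻¹; NonZero; >-nonZero; >-nonZero⁻¹)
open import Data.Nat.Properties
  using (_≟_; +-comm; m≤m+n; m≤n+m; ≤-trans; ≤-reflexive; m<n⇒0<n∸m; *-monoʳ-≤)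
open import Data.Product.Base using (_×_; _,_; proj₂)
open import Data.Rational.Base as ℚ using (ℚ; 0ℚ; _/_)
open import Relation.Binary.PropositionalEquality using (_≡_; _≢_; refl; subst)

data Tree : Set where
  leaf : Tree
  node : (l r : Tree) → Tree

V : Tree → ℕ
V leaf       = 0
V (node l r) = V l + V r + 1

J : Tree → ℕ
J leaf                  = 0
J (node leaf r)         = J r
J (node l@(node _ _) r) = J l + J r + 1

treesOfHeight≤ : ℕ → List Tree
treesOfHeight≤ zero    = leaf ∷ []
treesOfHeight≤ (suc h) =
  leaf ∷ cartesianProductWith node (treesOfHeight≤ h) (treesOfHeight≤ h)

-- A tree with n internal vertices has height at most n, so this lists every
-- tree with n internal vertices exactly once: see ∈-trees⁺, ∈-trees⁻ and
-- trees-unique.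
trees : ℕ → List Tree
trees n = filter (λ t → V t ≟ n) (treesOfHeight≤ n)

V≤⇒∈ : ∀ h t → V t ≤ h → t ∈ treesOfHeight≤ h
V≤⇒∈ zero    leaf       _ = here refl
V≤⇒∈ (suc h) leaf       _ = here refl
V≤⇒∈ zero    (node l r) p with () ← subst (_≤ 0) (+-comm (V l + V r) 1) p
V≤⇒∈ (suc h) (node l r) p =
  there (∈-cartesianProductWith⁺ node
    (V≤⇒∈ h l (≤-trans (m≤m+n (V l) (V r)) q))
    (V≤⇒∈ h r (≤-trans (m≤n+m (V r) (V l)) q)))
  where
  q : V l + V r ≤ h
  q = s≤s⁻¹ (subst (_≤ suc h) (+-comm (V l + V r) 1) p)

∈-trees⁺ : ∀ {n} t → V t ≡ n → t ∈ trees n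
∈-trees⁺ {n} t eq = ∈-filter⁺ (λ t → V t ≟ n) (V≤⇒∈ n t (≤-reflexive eq)) eq

∈-trees⁻ : ∀ {n} t → t ∈ trees n → V t ≡ n
∈-trees⁻ {n} t t∈ = proj₂ (∈-filter⁻ (λ t → V t ≟ n) {xs = treesOfHeight≤ n} t∈)

treesOfHeight≤-unique : ∀ h → Unique (treesOfHeight≤ h)
treesOfHeight≤-unique zero    = All.[] ∷ []
treesOfHeight≤-unique (suc h) =
  All.tabulate leaf≢ ∷ Unique.cartesianProductWith⁺ node node-injective ih ih
  where
  ts : List Tree
  ts = treesOfHeight≤ h

  ih : Unique ts
  ih = treesOfHeight≤-unique h

  node-injective : ∀ {w x y z} → node w y ≡ node x z → w ≡ x × y ≡ z
  node-injective refl = refl , refl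

  leaf≢ : ∀ {t} → t ∈ cartesianProductWith node ts ts → leaf ≢ t
  leaf≢ t∈ refl with _ , _ , _ , _ , () ← ∈-cartesianProductWith⁻ node ts ts t∈

trees-unique : ∀ n → Unique (trees n)
trees-unique n = Unique.filter⁺ (λ t → V t ≟ n) (treesOfHeight≤-unique n)

trees-nonEmpty : ∀ n → NonZero (length (trees n))
trees-nonEmpty n = nonEmpty (∈-trees⁺ (comb n) (V-comb n))
  where
  comb : ℕ → Tree
  comb zero    = leaf
  comb (suc k) = node leaf (comb k)

  V-comb : ∀ k → V (comb k) ≡ k
  V-comb zero = refl
  V-comb (suc k) rewrite V-comb k = +-comm k 1

  nonEmpty : ∀ {t} {ts : List Tree} → t ∈ ts → NonZero (length ts)
  nonEmpty (here _)  = _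
  nonEmpty (there _) = _

-- For n ≥ 1 we have 4 < 8 * n, so the subtraction is not truncated.
8n∸4-nonZero : ∀ n → .{{NonZero n}} → NonZero (8 * n ∸ 4)
8n∸4-nonZero n =
  >-nonZero (m<n⇒0<n∸m (≤-trans (m≤n+m 5 3) (*-monoʳ-≤ 8 (>-nonZero⁻¹ n))))

-- Expectation and variance of f under the uniform distribution on the entries
-- of the list xs.
mean : {A : Set} → (A → ℚ) → (xs : List A) → .{{NonZero (length xs)}} → ℚ
mean f xs = foldr ℚ._+_ 0ℚ (map f xs) ℚ.* (+ 1 / length xs)

variance : {A : Set} → (A → ℚ) → (xs : List A) → .{{NonZero (length xs)}} → ℚ
variance f xs = mean (λ x → (f x ℚ.- μ) ℚ.* (f x ℚ.- μ)) xs
  where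
  μ : ℚ
  μ = mean f xs

{-# OPTIONS --safe #-}
module Submission where

-- Let D = (left − right) edges between internal vertices. A tree with n ≥ 1
-- internal vertices has n − 1 such edges and J counts the left ones, so
-- J = (D + n − 1) / 2; mirroring negates D, hence D has mean 0 and
-- Var J = E[D²] / 4. The sum S n of D² satisfies a convolution recurrence whose
-- mixed terms vanish because the sums of D do, and it is solved by
-- S (n + 1) = 2 n c n, with c n the Catalan number; the formula then follows
-- from (n + 2) c (n + 1) = (4 n + 2) c n.

open import Defs
open import Data.Nat.Base using (ℕ; NonZero; _*_; _∸_; _^_)
open import Data.Integer.Base using (+_; _-_)
open import Data.Rational.Base using (_/_)
open import Relation.Binary.PropositionalEquality using (_≡_)

open import Data.Integer.Base as ℤ using (ℤ; 0ℤ; 1ℤ; -1ℤ; -_)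
import Data.Integer.Properties as ℤ
open import Algebra.Properties.AbelianGroup ℤ.+-0-abelianGroup using (∙-cancelʳ)
open import Data.Integer.Tactic.RingSolver using (solve-∀)
open import Data.List.Base using (List; []; _∷_; _++_; length; map; foldr; concatMap; cartesianProductWith)
import Data.List.Properties as List
open import Data.List.Membership.Propositional using (_∈_; lose; find)
open import Data.List.Membership.Propositional.Properties
  using (∈-map⁺; ∈-map⁻; ∈-concatMap⁺; ∈-concatMap⁻; ∈-cartesianProductWith⁺; ∈-cartesianProductWith⁻)
open import Data.List.Membership.Propositional.Properties.WithK using (unique∧set⇒bag)
open import Data.List.Relation.Binary.Disjoint.Propositional using (Disjoint)
open import Data.List.Relation.Binary.BagAndSetEquality using (∼bag⇒↭)
open import Data.List.Relation.Binary.Permutation.Propositional using (_↭_; ↭⇒↭ₛ)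
open import Data.List.Relation.Binary.Permutation.Propositional.Properties using (map⁺)
import Data.List.Relation.Binary.Permutation.Setoid.Properties as ↭ₛ
open import Data.List.Relation.Unary.All as All using ()
import Data.List.Relation.Unary.All.Properties as All
open import Data.List.Relation.Unary.AllPairs as AllPairs using ([]; _∷_)
import Data.List.Relation.Unary.AllPairs.Properties as AllPairs
open import Data.List.Relation.Unary.Any using (here; there)
open import Data.List.Relation.Unary.Unique.Propositional using (Unique)
import Data.List.Relation.Unary.Unique.Propositional.Properties as Unique
open import Data.Nat.Base as ℕ using (zero; suc; _≤_; _<_)
open import Data.Nat.Induction using (<-rec)
import Data.Nat.Properties as ℕ
open import Data.Product.Base using (_×_; _,_; uncurry; swap; map₁)
open import Data.Rational.Base as ℚ using (ℚ; 0ℚ; fromℚᵘ)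
import Data.Rational.Properties as ℚ
open import Data.Rational.Unnormalised.Base as ℚᵘ using (mkℚᵘ; *≡*)
import Data.Rational.Unnormalised.Properties as ℚᵘ
open import Function.Base using (_∘_; flip)
open import Function.Bundles using (mk⇔)
open import Relation.Binary.PropositionalEquality
  using (_≢_; refl; sym; trans; cong; cong₂; subst; setoid; module ≡-Reasoning)

-- Finite integer sums over lists.

private
  variable
    A B C : Set
    xs ys : List A

-- Without repetitions every member has multiplicity one, so equal membership already gives equal
-- multisets. All three reindexings of sums rest on this: swapped splits, trees cut at the root, and
-- mirrored trees.
set⇒↭ : Unique xs → Unique ys → (∀ {x} → x ∈ xs → x ∈ ys) → (∀ {x} → x ∈ ys → x ∈ xs) → xs ↭ ys
set⇒↭ uxs uys to from = ∼bag⇒↭ (unique∧set⇒bag uxs uys (mk⇔ to from))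

∑ : (A → ℤ) → List A → ℤ
∑ f xs = foldr ℤ._+_ 0ℤ (map f xs)

∑-↭ : (f : A → ℤ) → xs ↭ ys → ∑ f xs ≡ ∑ f ys
∑-↭ f xs↭ys =
  ↭ₛ.foldr-commMonoid (setoid ℤ) ℤ.+-0-isCommutativeMonoid (↭⇒↭ₛ (map⁺ f xs↭ys))

∑-cong-local : {f g : A → ℤ} → (∀ {x} → x ∈ xs → f x ≡ g x) → ∑ f xs ≡ ∑ g xs
∑-cong-local f≗g = cong (foldr ℤ._+_ 0ℤ) (List.map-cong-local (All.tabulate f≗g))

∑-map : (f : B → ℤ) (g : A → B) (xs : List A) → ∑ f (map g xs) ≡ ∑ (f ∘ g) xs
∑-map f g xs = cong (foldr ℤ._+_ 0ℤ) (sym (List.map-∘ xs))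

∑-++ : (f : A → ℤ) (xs ys : List A) → ∑ f (xs ++ ys) ≡ ∑ f xs ℤ.+ ∑ f ys
∑-++ f []       ys = sym (ℤ.+-identityˡ _)
∑-++ f (x ∷ xs) ys = trans (cong (ℤ._+_ (f x)) (∑-++ f xs ys)) (sym (ℤ.+-assoc (f x) _ _))

∑-concatMap : (f : B → ℤ) (g : A → List B) (xs : List A) →
              ∑ f (concatMap g xs) ≡ ∑ (∑ f ∘ g) xs
∑-concatMap f g []       = refl
∑-concatMap f g (x ∷ xs) =
  trans (∑-++ f (g x) (concatMap g xs)) (cong (ℤ._+_ (∑ f (g x))) (∑-concatMap f g xs))

∑-cartesianProductWith : (f : C → ℤ) (g : A → B → C) (xs : List A) (ys : List B) →
  ∑ f (cartesianProductWith g xs ys) ≡ ∑ (λ x → ∑ (f ∘ g x) ys) xs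
∑-cartesianProductWith f g []       ys = refl
∑-cartesianProductWith f g (x ∷ xs) ys =
  trans (∑-++ f (map (g x) ys) _) (cong₂ ℤ._+_ (∑-map f (g x) ys) (∑-cartesianProductWith f g xs ys))

∑-+ : (f g : A → ℤ) (xs : List A) → ∑ (λ x → f x ℤ.+ g x) xs ≡ ∑ f xs ℤ.+ ∑ g xs
∑-+ f g []       = refl
∑-+ f g (x ∷ xs) = trans (cong (ℤ._+_ (f x ℤ.+ g x)) (∑-+ f g xs)) (interchange (f x) (g x) _ _)
  where
  interchange : ∀ a b c d → a ℤ.+ b ℤ.+ (c ℤ.+ d) ≡ a ℤ.+ c ℤ.+ (b ℤ.+ d)
  interchange = solve-∀

∑-*ˡ : (k : ℤ) (f : A → ℤ) (xs : List A) → ∑ (λ x → k ℤ.* f x) xs ≡ k ℤ.* ∑ f xs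
∑-*ˡ k f []       = sym (ℤ.*-zeroʳ k)
∑-*ˡ k f (x ∷ xs) = trans (cong (ℤ._+_ (k ℤ.* f x)) (∑-*ˡ k f xs)) (sym (ℤ.*-distribˡ-+ k (f x) _))

∑-const : (k : ℤ) (xs : List A) → ∑ (λ _ → k) xs ≡ + length xs ℤ.* k
∑-const k []       = sym (ℤ.*-zeroˡ k)
∑-const k (x ∷ xs) = trans (cong (ℤ._+_ k) (∑-const k xs)) (sym (ℤ.suc-* (+ length xs) k))

sq : ℤ → ℤ
sq i = i ℤ.* i

-- The cross term of the expanded square is `2a` times the sum of `f`, hence zero. Applied once per
-- subtree in the recurrence for `S`.
∑-sq-shift : (a : ℤ) (f : A → ℤ) (xs : List A) → ∑ f xs ≡ 0ℤ →
             ∑ (λ x → sq (a ℤ.+ f x)) xs ≡ + length xs ℤ.* sq a ℤ.+ ∑ (sq ∘ f) xs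
∑-sq-shift a f xs ∑f≡0 = begin
  ∑ (λ x → sq (a ℤ.+ f x)) xs
    ≡⟨ ∑-cong-local {xs = xs} (λ {x} _ → expand a (f x)) ⟩
  ∑ (λ x → sq a ℤ.+ ((a ℤ.+ a) ℤ.* f x ℤ.+ sq (f x))) xs
    ≡⟨ ∑-+ (λ _ → sq a) (λ x → (a ℤ.+ a) ℤ.* f x ℤ.+ sq (f x)) xs ⟩
  ∑ (λ _ → sq a) xs ℤ.+ ∑ (λ x → (a ℤ.+ a) ℤ.* f x ℤ.+ sq (f x)) xs
    ≡⟨ cong₂ ℤ._+_ (∑-const (sq a) xs) (∑-+ (λ x → (a ℤ.+ a) ℤ.* f x) (sq ∘ f) xs) ⟩
  + length xs ℤ.* sq a ℤ.+ (∑ (λ x → (a ℤ.+ a) ℤ.* f x) xs ℤ.+ ∑ (sq ∘ f) xs)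
    ≡⟨ cong (λ z → + length xs ℤ.* sq a ℤ.+ (z ℤ.+ ∑ (sq ∘ f) xs)) linear≡0 ⟩
  + length xs ℤ.* sq a ℤ.+ (0ℤ ℤ.+ ∑ (sq ∘ f) xs)
    ≡⟨ cong (ℤ._+_ (+ length xs ℤ.* sq a)) (ℤ.+-identityˡ _) ⟩
  + length xs ℤ.* sq a ℤ.+ ∑ (sq ∘ f) xs
    ∎
  where
  open ≡-Reasoning
  expand : ∀ a y → (a ℤ.+ y) ℤ.* (a ℤ.+ y) ≡ a ℤ.* a ℤ.+ ((a ℤ.+ a) ℤ.* y ℤ.+ y ℤ.* y)
  expand = solve-∀
  linear≡0 : ∑ (λ x → (a ℤ.+ a) ℤ.* f x) xs ≡ 0ℤ
  linear≡0 = trans (∑-*ˡ (a ℤ.+ a) f xs) (trans (cong (ℤ._*_ (a ℤ.+ a)) ∑f≡0) (ℤ.*-zeroʳ (a ℤ.+ a)))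

-- Convolution sums over `i + j = n`.

splits : ℕ → List (ℕ × ℕ)
splits zero    = (0 , 0) ∷ []
splits (suc n) = (0 , suc n) ∷ map (map₁ suc) (splits n)

∈-splits⁺ : ∀ i j → (i , j) ∈ splits (i ℕ.+ j)
∈-splits⁺ zero    zero    = here refl
∈-splits⁺ zero    (suc j) = here refl
∈-splits⁺ (suc i) j       = there (∈-map⁺ (map₁ suc) (∈-splits⁺ i j))

∈-splits⁻ : ∀ n {i j} → (i , j) ∈ splits n → i ℕ.+ j ≡ n
∈-splits⁻ zero    (here refl) = refl
∈-splits⁻ (suc n) (here refl) = refl
∈-splits⁻ (suc n) (there p∈) with _ , q∈ , refl ← ∈-map⁻ (map₁ suc) p∈ = cong suc (∈-splits⁻ n q∈)

splits-unique : ∀ n → Unique (splits n)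
splits-unique zero    = All.[] ∷ []
splits-unique (suc n) =
  All.map⁺ (All.tabulate λ _ ()) ∷ Unique.map⁺ (λ { refl → refl }) (splits-unique n)

-- Sealed so that goals keep `conv F n` folded instead of unfolding it along `splits`.
opaque
  conv : (ℕ → ℕ → ℤ) → ℕ → ℤ
  conv F n = ∑ (uncurry F) (splits n)

  conv-zero : ∀ F → conv F 0 ≡ F 0 0
  conv-zero F = ℤ.+-identityʳ (F 0 0)

  conv-suc : ∀ F n → conv F (suc n) ≡ F 0 (suc n) ℤ.+ conv (F ∘ suc) n
  conv-suc F n = cong (ℤ._+_ (F 0 (suc n))) (∑-map (uncurry F) (map₁ suc) (splits n))

  conv-cong : ∀ {F G} n → (∀ i j → i ℕ.+ j ≡ n → F i j ≡ G i j) → conv F n ≡ conv G n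
  conv-cong n F≗G = ∑-cong-local {xs = splits n} (λ {(i , j)} p∈ → F≗G i j (∈-splits⁻ n p∈))

  conv-+ : ∀ F G n → conv (λ i j → F i j ℤ.+ G i j) n ≡ conv F n ℤ.+ conv G n
  conv-+ F G n = ∑-+ (uncurry F) (uncurry G) (splits n)

  conv-*ˡ : ∀ k F n → conv (λ i j → k ℤ.* F i j) n ≡ k ℤ.* conv F n
  conv-*ˡ k F n = ∑-*ˡ k (uncurry F) (splits n)

  -- Exchanging the two parts permutes the splits of `n`.
  conv-flip : ∀ F n → conv (flip F) n ≡ conv F n
  conv-flip F n = trans (sym (∑-map (uncurry F) swap (splits n))) (∑-↭ (uncurry F) swap↭)
    where
    to : ∀ {p} → p ∈ map swap (splits n) → p ∈ splits n
    to p∈ with (i , j) , q∈ , refl ← ∈-map⁻ swap p∈ =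
      subst (λ m → (j , i) ∈ splits m) (trans (ℕ.+-comm j i) (∈-splits⁻ n q∈)) (∈-splits⁺ j i)
    from : ∀ {p} → p ∈ splits n → p ∈ map swap (splits n)
    from {i , j} p∈ = ∈-map⁺ swap
      (subst (λ m → (j , i) ∈ splits m) (trans (ℕ.+-comm j i) (∈-splits⁻ n p∈)) (∈-splits⁺ j i))
    swap↭ : map swap (splits n) ↭ splits n
    swap↭ = set⇒↭ (Unique.map⁺ (λ { refl → refl }) (splits-unique n)) (splits-unique n) to from

  ∑-concatMap-splits : (f : A → ℤ) (g : ℕ × ℕ → List A) (n : ℕ) →
                       ∑ f (concatMap g (splits n)) ≡ conv (λ i j → ∑ f (g (i , j))) n
  ∑-concatMap-splits f g n = ∑-concatMap f g (splits n)

-- Symmetrisation: adding the flipped sum replaces the weight `i` by `i + j = n`. Both the Catalan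
-- ratio and the closed form of `S` depend on it.
conv-weighted : ∀ F n → (∀ i j → F i j ≡ F j i) →
                conv (λ i j → + i ℤ.* F i j) n ℤ.+ conv (λ i j → + i ℤ.* F i j) n ≡ + n ℤ.* conv F n
conv-weighted F n F-comm = begin
  conv (λ i j → + i ℤ.* F i j) n ℤ.+ conv (λ i j → + i ℤ.* F i j) n
    ≡⟨ cong (ℤ._+_ (conv (λ i j → + i ℤ.* F i j) n)) (conv-flip (λ i j → + i ℤ.* F i j) n) ⟨
  conv (λ i j → + i ℤ.* F i j) n ℤ.+ conv (λ i j → + j ℤ.* F j i) n
    ≡⟨ conv-+ (λ i j → + i ℤ.* F i j) (λ i j → + j ℤ.* F j i) n ⟨
  conv (λ i j → + i ℤ.* F i j ℤ.+ + j ℤ.* F j i) n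
    ≡⟨ conv-cong n collect ⟩
  conv (λ i j → + n ℤ.* F i j) n
    ≡⟨ conv-*ˡ (+ n) F n ⟩
  + n ℤ.* conv F n
    ∎
  where
  open ≡-Reasoning
  collect : ∀ i j → i ℕ.+ j ≡ n → + i ℤ.* F i j ℤ.+ + j ℤ.* F j i ≡ + n ℤ.* F i j
  collect i j refl rewrite F-comm j i = sym (ℤ.*-distribʳ-+ (F i j) (+ i) (+ j))

-- Decomposition of trees at the root.

joins : ℕ × ℕ → List Tree
joins (i , j) = cartesianProductWith node (trees i) (trees j)

∈-joins⁺ : ∀ l r → node l r ∈ joins (V l , V r)
∈-joins⁺ l r = ∈-cartesianProductWith⁺ node (∈-trees⁺ l refl) (∈-trees⁺ r refl)

-- The index pair is forced by the tree, so matching on two such proofs for one tree identifies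
-- their pairs; this makes different blocks `joins p` disjoint.
data Joined : ℕ × ℕ → Tree → Set where
  joined : ∀ l r → Joined (V l , V r) (node l r)

∈-joins⁻ : ∀ {p t} → t ∈ joins p → Joined p t
∈-joins⁻ {i , j} t∈
  with l , r , l∈ , r∈ , refl ← ∈-cartesianProductWith⁻ node (trees i) (trees j) t∈
  with refl ← ∈-trees⁻ {i} l l∈ | refl ← ∈-trees⁻ {j} r r∈ = joined l r

-- A tree with `suc n` internal vertices is a node, and the sizes of its subtrees form a split of
-- `n` because the root accounts for one vertex. That split names the only block containing the
-- tree.
trees-suc : ∀ n → trees (suc n) ↭ concatMap joins (splits n)
trees-suc n = set⇒↭ (trees-unique (suc n)) joins-unique to from
  where
  joins-disjoint : ∀ {p q} → p ≢ q → Disjoint (joins p) (joins q)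
  joins-disjoint {p} {q} p≢q (t∈p , t∈q) with ∈-joins⁻ {p} t∈p | ∈-joins⁻ {q} t∈q
  ... | joined _ _ | joined _ _ = p≢q refl

  joins-unique : Unique (concatMap joins (splits n))
  joins-unique = Unique.concat⁺
    (All.map⁺ (All.tabulate λ {(i , j)} _ →
      Unique.cartesianProductWith⁺ node (λ { refl → refl , refl }) (trees-unique i) (trees-unique j)))
    (AllPairs.map⁺ (AllPairs.map joins-disjoint (splits-unique n)))

  to : ∀ {t} → t ∈ trees (suc n) → t ∈ concatMap joins (splits n)
  to {leaf}     t∈ with () ← ∈-trees⁻ {suc n} leaf t∈
  to {node l r} t∈ = ∈-concatMap⁺ joins (lose
    (subst (λ m → (V l , V r) ∈ splits m)
           (ℕ.suc-injective (trans (ℕ.+-comm 1 _) (∈-trees⁻ {suc n} (node l r) t∈)))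
           (∈-splits⁺ (V l) (V r)))
    (∈-joins⁺ l r))

  from : ∀ {t} → t ∈ concatMap joins (splits n) → t ∈ trees (suc n)
  from t∈ with p , p∈ , t∈p ← find (∈-concatMap⁻ joins {xs = splits n} t∈) with ∈-joins⁻ {p} t∈p
  ... | joined l r = ∈-trees⁺ (node l r) (trans (ℕ.+-comm _ 1) (cong suc (∈-splits⁻ n p∈)))

∑-trees-suc : ∀ f n → ∑ f (trees (suc n)) ≡
              conv (λ i j → ∑ (λ l → ∑ (λ r → f (node l r)) (trees j)) (trees i)) n
∑-trees-suc f n = begin
  ∑ f (trees (suc n))                      ≡⟨ ∑-↭ f (trees-suc n) ⟩
  ∑ f (concatMap joins (splits n))         ≡⟨ ∑-concatMap-splits f joins n ⟩
  conv (λ i j → ∑ f (joins (i , j))) n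
    ≡⟨ conv-cong n (λ i j _ → ∑-cartesianProductWith f node (trees i) (trees j)) ⟩
  conv (λ i j → ∑ (λ l → ∑ (λ r → f (node l r)) (trees j)) (trees i)) n ∎
  where open ≡-Reasoning

-- Catalan numbers: convolution recurrence and ratio of consecutive terms.

c : ℕ → ℤ
c n = + length (trees n)

c² : ℕ → ℕ → ℤ
c² i j = c i ℤ.* c j

c-suc : ∀ n → c (suc n) ≡ conv c² n
c-suc n = begin
  c (suc n)                      ≡⟨ ℤ.*-identityʳ _ ⟨
  c (suc n) ℤ.* 1ℤ               ≡⟨ ∑-const 1ℤ (trees (suc n)) ⟨
  ∑ (λ _ → 1ℤ) (trees (suc n))   ≡⟨ ∑-trees-suc (λ _ → 1ℤ) n ⟩
  conv (λ i j → ∑ (λ l → ∑ (λ r → 1ℤ) (trees j)) (trees i)) n ≡⟨ conv-cong n pairs ⟩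
  conv c² n ∎
  where
  open ≡-Reasoning
  pairs : ∀ i j → i ℕ.+ j ≡ n → ∑ (λ l → ∑ (λ r → 1ℤ) (trees j)) (trees i) ≡ c² i j
  pairs i j _ = trans (∑-const (∑ (λ r → 1ℤ) (trees j)) (trees i))
    (cong (ℤ._*_ (c i)) (trans (∑-const 1ℤ (trees j)) (ℤ.*-identityʳ (c j))))

-- Evaluate ∑ 2 (i + 1) c i c j over i + j = n in two ways: by symmetry it is
-- (n + 2) c (n + 1), and by the recurrence at smaller indices it is (4 n + 2) c n.
c-ratio : ∀ n → (+ n ℤ.+ + 2) ℤ.* c (suc n) ≡ (+ 4 ℤ.* + n ℤ.+ + 2) ℤ.* c n
c-ratio = <-rec _ step
  where
  open ≡-Reasoning
  step : ∀ n → (∀ {m} → m < n → (+ m ℤ.+ + 2) ℤ.* c (suc m) ≡ (+ 4 ℤ.* + m ℤ.+ + 2) ℤ.* c m) →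
         (+ n ℤ.+ + 2) ℤ.* c (suc n) ≡ (+ 4 ℤ.* + n ℤ.+ + 2) ℤ.* c n
  step zero    _   = refl
  step (suc m) rec = begin
    (+ suc m ℤ.+ + 2) ℤ.* c (2 ℕ.+ m)
      ≡⟨ ℤ.*-distribʳ-+ (c (2 ℕ.+ m)) (+ suc m) (+ 2) ⟩
    + suc m ℤ.* c (2 ℕ.+ m) ℤ.+ + 2 ℤ.* c (2 ℕ.+ m)
      ≡⟨ cong (λ z → + suc m ℤ.* z ℤ.+ + 2 ℤ.* z) (c-suc (suc m)) ⟩
    + suc m ℤ.* conv c² (suc m) ℤ.+ + 2 ℤ.* conv c² (suc m)
      ≡⟨ cong (λ z → z ℤ.+ + 2 ℤ.* conv c² (suc m)) (conv-weighted c² (suc m) c²-comm) ⟨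
    W (suc m) ℤ.+ W (suc m) ℤ.+ + 2 ℤ.* conv c² (suc m)
      ≡⟨ double (W (suc m)) (conv c² (suc m)) ⟩
    + 2 ℤ.* (W (suc m) ℤ.+ conv c² (suc m))
      ≡⟨ cong (ℤ._*_ (+ 2)) (conv-+ (λ i j → + i ℤ.* c² i j) c² (suc m)) ⟨
    + 2 ℤ.* conv (λ i j → + i ℤ.* c² i j ℤ.+ c² i j) (suc m)
      -- The term `i = 0` is split off because the induction hypothesis concerns `c (suc i)`. In the
      -- remaining terms `i ≤ m < suc m`, so it applies.
      ≡⟨ cong (ℤ._*_ (+ 2)) (conv-suc (λ i j → + i ℤ.* c² i j ℤ.+ c² i j) m) ⟩
    + 2 ℤ.* (0ℤ ℤ.* c² 0 (suc m) ℤ.+ c² 0 (suc m) ℤ.+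
             conv (λ i j → + suc i ℤ.* c² (suc i) j ℤ.+ c² (suc i) j) m)
      ≡⟨ cong (λ z → + 2 ℤ.* (0ℤ ℤ.* c² 0 (suc m) ℤ.+ c² 0 (suc m) ℤ.+ z)) (conv-cong m shrink) ⟩
    + 2 ℤ.* (0ℤ ℤ.* c² 0 (suc m) ℤ.+ c² 0 (suc m) ℤ.+
             conv (λ i j → + 4 ℤ.* (+ i ℤ.* c² i j) ℤ.+ + 2 ℤ.* c² i j) m)
      ≡⟨ cong (λ z → + 2 ℤ.* (0ℤ ℤ.* c² 0 (suc m) ℤ.+ c² 0 (suc m) ℤ.+ z)) linear ⟩
    + 2 ℤ.* (0ℤ ℤ.* c² 0 (suc m) ℤ.+ c² 0 (suc m) ℤ.+ (+ 4 ℤ.* W m ℤ.+ + 2 ℤ.* c (suc m)))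
      ≡⟨ regroup (c (suc m)) (W m) ⟩
    + 4 ℤ.* (W m ℤ.+ W m) ℤ.+ + 6 ℤ.* c (suc m)
      ≡⟨ cong (λ z → + 4 ℤ.* z ℤ.+ + 6 ℤ.* c (suc m)) (conv-weighted c² m c²-comm) ⟩
    + 4 ℤ.* (+ m ℤ.* conv c² m) ℤ.+ + 6 ℤ.* c (suc m)
      ≡⟨ cong (λ z → + 4 ℤ.* (+ m ℤ.* z) ℤ.+ + 6 ℤ.* c (suc m)) (c-suc m) ⟨
    + 4 ℤ.* (+ m ℤ.* c (suc m)) ℤ.+ + 6 ℤ.* c (suc m)
      ≡⟨ final (+ m) (c (suc m)) ⟩
    (+ 4 ℤ.* + suc m ℤ.+ + 2) ℤ.* c (suc m)
      ∎
    where
    c²-comm : ∀ i j → c² i j ≡ c² j i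
    c²-comm i j = ℤ.*-comm (c i) (c j)
    W : ℕ → ℤ
    W = conv (λ i j → + i ℤ.* c² i j)
    double : ∀ w k → w ℤ.+ w ℤ.+ + 2 ℤ.* k ≡ + 2 ℤ.* (w ℤ.+ k)
    double = solve-∀
    -- The factors `1ℤ` stand for `c 0`, which evaluates to one.
    regroup : ∀ k w → + 2 ℤ.* (0ℤ ℤ.* (1ℤ ℤ.* k) ℤ.+ 1ℤ ℤ.* k ℤ.+ (+ 4 ℤ.* w ℤ.+ + 2 ℤ.* k)) ≡
                      + 4 ℤ.* (w ℤ.+ w) ℤ.+ + 6 ℤ.* k
    regroup = solve-∀
    final : ∀ m k → + 4 ℤ.* (m ℤ.* k) ℤ.+ + 6 ℤ.* k ≡ (+ 4 ℤ.* (1ℤ ℤ.+ m) ℤ.+ + 2) ℤ.* k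
    final = solve-∀
    linear : conv (λ i j → + 4 ℤ.* (+ i ℤ.* c² i j) ℤ.+ + 2 ℤ.* c² i j) m ≡
             + 4 ℤ.* W m ℤ.+ + 2 ℤ.* c (suc m)
    linear = trans (conv-+ (λ i j → + 4 ℤ.* (+ i ℤ.* c² i j)) (λ i j → + 2 ℤ.* c² i j) m)
      (cong₂ ℤ._+_ (conv-*ˡ (+ 4) (λ i j → + i ℤ.* c² i j) m)
                   (trans (conv-*ˡ (+ 2) c² m) (cong (ℤ._*_ (+ 2)) (sym (c-suc m)))))
    shrink : ∀ i j → i ℕ.+ j ≡ m → + suc i ℤ.* c² (suc i) j ℤ.+ c² (suc i) j ≡
                                   + 4 ℤ.* (+ i ℤ.* c² i j) ℤ.+ + 2 ℤ.* c² i j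
    shrink i j i+j≡m = begin
      + suc i ℤ.* c² (suc i) j ℤ.+ c² (suc i) j ≡⟨ factor (+ i) (c (suc i)) (c j) ⟩
      (+ i ℤ.+ + 2) ℤ.* c (suc i) ℤ.* c j
        ≡⟨ cong (λ z → z ℤ.* c j) (rec (ℕ.s≤s (subst (i ≤_) i+j≡m (ℕ.m≤m+n i j)))) ⟩
      (+ 4 ℤ.* + i ℤ.+ + 2) ℤ.* c i ℤ.* c j ≡⟨ unfactor (+ i) (c i) (c j) ⟩
      + 4 ℤ.* (+ i ℤ.* c² i j) ℤ.+ + 2 ℤ.* c² i j ∎
      where
      factor : ∀ i a b → (1ℤ ℤ.+ i) ℤ.* (a ℤ.* b) ℤ.+ a ℤ.* b ≡ (i ℤ.+ + 2) ℤ.* a ℤ.* b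
      factor = solve-∀
      unfactor : ∀ i a b → (+ 4 ℤ.* i ℤ.+ + 2) ℤ.* a ℤ.* b ≡ + 4 ℤ.* (i ℤ.* (a ℤ.* b)) ℤ.+ + 2 ℤ.* (a ℤ.* b)
      unfactor = solve-∀

-- Mirror symmetry, and `J` in terms of `D`.

mirror : Tree → Tree
mirror leaf       = leaf
mirror (node l r) = node (mirror r) (mirror l)

mirror-involutive : ∀ t → mirror (mirror t) ≡ t
mirror-involutive leaf       = refl
mirror-involutive (node l r) = cong₂ node (mirror-involutive l) (mirror-involutive r)

V-mirror : ∀ t → V (mirror t) ≡ V t
V-mirror leaf = refl
V-mirror (node l r) rewrite V-mirror l | V-mirror r = cong (ℕ._+ 1) (ℕ.+-comm (V r) (V l))

-- `mirror` is an involution preserving `V`, hence a bijection on the trees of each size.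
mirror-↭ : ∀ n → map mirror (trees n) ↭ trees n
mirror-↭ n = set⇒↭ (Unique.map⁺ mirror-injective (trees-unique n)) (trees-unique n) to from
  where
  mirror-injective : ∀ {s t} → mirror s ≡ mirror t → s ≡ t
  mirror-injective {s} {t} eq =
    trans (sym (mirror-involutive s)) (trans (cong mirror eq) (mirror-involutive t))

  to : ∀ {t} → t ∈ map mirror (trees n) → t ∈ trees n
  to t∈ with s , s∈ , refl ← ∈-map⁻ mirror t∈ =
    ∈-trees⁺ (mirror s) (trans (V-mirror s) (∈-trees⁻ {n} s s∈))

  from : ∀ {t} → t ∈ trees n → t ∈ map mirror (trees n)
  from {t} t∈ = subst (_∈ map mirror (trees n)) (mirror-involutive t)
    (∈-map⁺ mirror (∈-trees⁺ (mirror t) (trans (V-mirror t) (∈-trees⁻ {n} t t∈))))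

-- Applied to the size of a subtree, it tells whether the edge from the parent down to that subtree
-- ends in an internal vertex.
sgn : ℕ → ℤ
sgn zero    = 0ℤ
sgn (suc _) = 1ℤ

-- The number of left minus the number of right edges between internal vertices.
D : Tree → ℤ
D leaf       = 0ℤ
D (node l r) = (sgn (V l) - sgn (V r)) ℤ.+ D l ℤ.+ D r

D-mirror : ∀ t → D (mirror t) ≡ - D t
D-mirror leaf = refl
D-mirror (node l r) rewrite V-mirror l | V-mirror r | D-mirror l | D-mirror r =
  flip-sign (sgn (V l)) (sgn (V r)) (D l) (D r)
  where
  flip-sign : ∀ x y a b → y - x ℤ.+ - b ℤ.+ - a ≡ - (x - y ℤ.+ a ℤ.+ b)
  flip-sign = solve-∀

-- Mirroring permutes the trees and negates `D`, so the sum equals its own negative.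
∑D≡0 : ∀ n → ∑ D (trees n) ≡ 0ℤ
∑D≡0 n = i≡-i⇒i≡0 (begin
  ∑ D (trees n)                    ≡⟨ ∑-↭ D (mirror-↭ n) ⟨
  ∑ D (map mirror (trees n))       ≡⟨ ∑-map D mirror (trees n) ⟩
  ∑ (D ∘ mirror) (trees n)         ≡⟨ ∑-cong-local {xs = trees n} (λ {t} _ →
                                        trans (D-mirror t) (sym (ℤ.-1*i≡-i (D t)))) ⟩
  ∑ (λ t → -1ℤ ℤ.* D t) (trees n)  ≡⟨ ∑-*ˡ -1ℤ D (trees n) ⟩
  -1ℤ ℤ.* ∑ D (trees n)            ≡⟨ ℤ.-1*i≡-i _ ⟩
  - ∑ D (trees n)                  ∎)
  where
  open ≡-Reasoning
  i≡-i⇒i≡0 : ∀ {i} → i ≡ - i → i ≡ 0ℤ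
  i≡-i⇒i≡0 {+ zero}        _  = refl
  i≡-i⇒i≡0 {+ suc _}       ()
  i≡-i⇒i≡0 {ℤ.-[1+ _ ]}    ()

sgn-V-node : ∀ l r → sgn (V (node l r)) ≡ 1ℤ
sgn-V-node l r = cong sgn (ℕ.+-comm (V l ℕ.+ V r) 1)

-- Merges the two node clauses of `J`: the extra jump occurs exactly when `sgn (V l)` is one.
J-node : ∀ l r → + J (node l r) ≡ + J l ℤ.+ + J r ℤ.+ sgn (V l)
J-node leaf           r = sym (trans (ℤ.+-identityʳ _) (ℤ.+-identityˡ (+ J r)))
J-node l@(node l₁ l₂) r = cong (λ z → + J l ℤ.+ + J r ℤ.+ z) (sym (sgn-V-node l₁ l₂))

-- With `L` left and `R` right edges between internal vertices, `J = L`, `D = L - R` and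
-- `L + R = V - sgn V`. The `sgn` term, in place of a constant one, makes the identity hold for
-- `leaf` too, so the induction closes.
2J≡D+V : ∀ t → + 2 ℤ.* + J t ℤ.+ sgn (V t) ≡ D t ℤ.+ + V t
2J≡D+V leaf       = refl
2J≡D+V (node l r) = begin
  + 2 ℤ.* + J (node l r) ℤ.+ sgn (V (node l r))
    ≡⟨ cong₂ (λ a b → + 2 ℤ.* a ℤ.+ b) (J-node l r) (sgn-V-node l r) ⟩
  + 2 ℤ.* (+ J l ℤ.+ + J r ℤ.+ x) ℤ.+ 1ℤ
    ≡⟨ before (+ J l) (+ J r) x y ⟩
  (x - y) ℤ.+ (+ 2 ℤ.* + J l ℤ.+ x) ℤ.+ (+ 2 ℤ.* + J r ℤ.+ y) ℤ.+ 1ℤ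
    ≡⟨ cong₂ (λ a b → (x - y) ℤ.+ a ℤ.+ b ℤ.+ 1ℤ) (2J≡D+V l) (2J≡D+V r) ⟩
  (x - y) ℤ.+ (D l ℤ.+ + V l) ℤ.+ (D r ℤ.+ + V r) ℤ.+ 1ℤ
    ≡⟨ after (x - y) (D l) (D r) (+ V l) (+ V r) ⟩
  D (node l r) ℤ.+ + V (node l r)
    ∎
  where
  open ≡-Reasoning
  x y : ℤ
  x = sgn (V l)
  y = sgn (V r)
  before : ∀ a b x y → + 2 ℤ.* (a ℤ.+ b ℤ.+ x) ℤ.+ 1ℤ ≡
           (x - y) ℤ.+ (+ 2 ℤ.* a ℤ.+ x) ℤ.+ (+ 2 ℤ.* b ℤ.+ y) ℤ.+ 1ℤ
  before = solve-∀
  after : ∀ e a b u v → e ℤ.+ (a ℤ.+ u) ℤ.+ (b ℤ.+ v) ℤ.+ 1ℤ ≡ e ℤ.+ a ℤ.+ b ℤ.+ (u ℤ.+ v ℤ.+ 1ℤ)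
  after = solve-∀

-- The second moment of `D`.

S : ℕ → ℤ
S n = ∑ (sq ∘ D) (trees n)

-- The square of the root's own contribution to `D`: one if exactly one subtree is a leaf, and zero
-- otherwise.
ε² : ℕ → ℕ → ℤ
ε² i j = sq (sgn i - sgn j)

-- On a node `D` is `ε + D l + D r`. Summing its square first over `r` with shift `ε + D l`, then
-- over `l` with shift `ε`, loses all mixed terms by `∑D≡0`.
S-suc : ∀ n → S (suc n) ≡
        conv (λ i j → ε² i j ℤ.* c² i j ℤ.+ (S i ℤ.* c j ℤ.+ S j ℤ.* c i)) n
S-suc n = trans (∑-trees-suc (sq ∘ D) n) (conv-cong n pairs)
  where
  open ≡-Reasoning
  pairs : ∀ i j → i ℕ.+ j ≡ n →
    ∑ (λ l → ∑ (λ r → sq (D (node l r))) (trees j)) (trees i) ≡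
    ε² i j ℤ.* c² i j ℤ.+ (S i ℤ.* c j ℤ.+ S j ℤ.* c i)
  pairs i j _ = begin
    ∑ (λ l → ∑ (λ r → sq (D (node l r))) (trees j)) (trees i)
      ≡⟨ ∑-cong-local {xs = trees i} inner ⟩
    ∑ (λ l → c j ℤ.* sq (ε ℤ.+ D l) ℤ.+ S j) (trees i)
      ≡⟨ ∑-+ (λ l → c j ℤ.* sq (ε ℤ.+ D l)) (λ _ → S j) (trees i) ⟩
    ∑ (λ l → c j ℤ.* sq (ε ℤ.+ D l)) (trees i) ℤ.+ ∑ (λ _ → S j) (trees i)
      ≡⟨ cong₂ ℤ._+_ (∑-*ˡ (c j) (λ l → sq (ε ℤ.+ D l)) (trees i)) (∑-const (S j) (trees i)) ⟩
    c j ℤ.* ∑ (λ l → sq (ε ℤ.+ D l)) (trees i) ℤ.+ c i ℤ.* S j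
      ≡⟨ cong (λ z → c j ℤ.* z ℤ.+ c i ℤ.* S j) (∑-sq-shift ε D (trees i) (∑D≡0 i)) ⟩
    c j ℤ.* (c i ℤ.* sq ε ℤ.+ S i) ℤ.+ c i ℤ.* S j
      ≡⟨ rearrange (c i) (c j) (S i) (S j) (sq ε) ⟩
    ε² i j ℤ.* c² i j ℤ.+ (S i ℤ.* c j ℤ.+ S j ℤ.* c i) ∎
    where
    ε : ℤ
    ε = sgn i - sgn j
    rearrange : ∀ a b s t e → b ℤ.* (a ℤ.* e ℤ.+ s) ℤ.+ a ℤ.* t ≡ e ℤ.* (a ℤ.* b) ℤ.+ (s ℤ.* b ℤ.+ t ℤ.* a)
    rearrange = solve-∀
    inner : ∀ {l} → l ∈ trees i →
            ∑ (λ r → sq (D (node l r))) (trees j) ≡ c j ℤ.* sq (ε ℤ.+ D l) ℤ.+ S j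
    -- Membership fixes `V l` and `V r` as `i` and `j`, so the root contribution is the constant `ε`
    -- throughout the double sum.
    inner {l} l∈ = trans
      (∑-cong-local {xs = trees j} λ {r} r∈ → cong₂ (λ a b → sq ((sgn a - sgn b) ℤ.+ D l ℤ.+ D r))
        (∈-trees⁻ {i} l l∈) (∈-trees⁻ {j} r r∈))
      (∑-sq-shift (ε ℤ.+ D l) D (trees j) (∑D≡0 j))

-- Only the two splits with exactly one zero part contribute.
conv-ε² : ∀ (F : ℕ → ℕ → ℤ) n → conv (λ i j → ε² i j ℤ.* F i j) (suc n) ≡ F 0 (suc n) ℤ.+ F (suc n) 0
conv-ε² F n = trans (conv-suc (λ i j → ε² i j ℤ.* F i j) n)
  (cong₂ ℤ._+_ (ℤ.*-identityˡ (F 0 (suc n))) (last (F ∘ suc) n))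
  where
  -- Once the first part is positive its `sgn` is one whatever its value, so the weight is `ε² 1 j`
  -- and survives only at `j = 0`.
  last : ∀ (G : ℕ → ℕ → ℤ) n → conv (λ i j → ε² 1 j ℤ.* G i j) n ≡ G n 0
  last G zero    = trans (conv-zero (λ i j → ε² 1 j ℤ.* G i j)) (ℤ.*-identityˡ (G 0 0))
  last G (suc n) = trans (conv-suc (λ i j → ε² 1 j ℤ.* G i j) n)
    (trans (cong₂ ℤ._+_ (ℤ.*-zeroˡ (G 0 (suc n))) (last (G ∘ suc) n)) (ℤ.+-identityˡ (G (suc n) 0)))

-- Strong induction. For `n = m + 1` the root terms give `2 c (m + 1)`. Each of the two convolutions
-- of `S` with `c` gives `m c (m + 1)`: the hypothesis turns `S (i + 1)` into `2 i c i`, and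
-- `conv-weighted` evaluates the sum.
S≡2nc : ∀ n → S (suc n) ≡ + 2 ℤ.* + n ℤ.* c n
S≡2nc = <-rec _ step
  where
  open ≡-Reasoning
  step : ∀ n → (∀ {m} → m < n → S (suc m) ≡ + 2 ℤ.* + m ℤ.* c m) → S (suc n) ≡ + 2 ℤ.* + n ℤ.* c n
  step zero    _   = refl
  step (suc m) rec = begin
    S (2 ℕ.+ m)
      ≡⟨ S-suc (suc m) ⟩
    conv (λ i j → ε² i j ℤ.* c² i j ℤ.+ (S i ℤ.* c j ℤ.+ S j ℤ.* c i)) (suc m)
      ≡⟨ conv-+ (λ i j → ε² i j ℤ.* c² i j) (λ i j → S i ℤ.* c j ℤ.+ S j ℤ.* c i) (suc m) ⟩
    conv (λ i j → ε² i j ℤ.* c² i j) (suc m) ℤ.+ conv (λ i j → S i ℤ.* c j ℤ.+ S j ℤ.* c i) (suc m)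
      ≡⟨ cong₂ ℤ._+_ (conv-ε² c² m) (conv-+ Sc (flip Sc) (suc m)) ⟩
    c² 0 (suc m) ℤ.+ c² (suc m) 0 ℤ.+ (conv Sc (suc m) ℤ.+ conv (flip Sc) (suc m))
      ≡⟨ cong₂ (λ a b → c² 0 (suc m) ℤ.+ c² (suc m) 0 ℤ.+ (a ℤ.+ b))
               convSc (trans (conv-flip Sc (suc m)) convSc) ⟩
    c² 0 (suc m) ℤ.+ c² (suc m) 0 ℤ.+ (+ m ℤ.* c (suc m) ℤ.+ + m ℤ.* c (suc m))
      ≡⟨ final (+ m) (c (suc m)) ⟩
    + 2 ℤ.* + suc m ℤ.* c (suc m)
      ∎
    where
    Sc : ℕ → ℕ → ℤ
    Sc i j = S i ℤ.* c j
    final : ∀ m k → 1ℤ ℤ.* k ℤ.+ k ℤ.* 1ℤ ℤ.+ (m ℤ.* k ℤ.+ m ℤ.* k) ≡ + 2 ℤ.* (1ℤ ℤ.+ m) ℤ.* k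
    final = solve-∀
    split : ∀ i a b → + 2 ℤ.* i ℤ.* a ℤ.* b ≡ i ℤ.* (a ℤ.* b) ℤ.+ i ℤ.* (a ℤ.* b)
    split = solve-∀
    W : ℕ → ℕ → ℤ
    W i j = + i ℤ.* c² i j
    convSc : conv Sc (suc m) ≡ + m ℤ.* c (suc m)
    convSc = begin
      conv Sc (suc m)                                ≡⟨ conv-suc Sc m ⟩
      -- The `i = 0` term vanishes because `S 0` evaluates to zero; the others involve only
      -- `S (suc i)` with `i ≤ m`.
      0ℤ ℤ.* c (suc m) ℤ.+ conv (Sc ∘ suc) m         ≡⟨ trans
        (cong (λ z → z ℤ.+ conv (Sc ∘ suc) m) (ℤ.*-zeroˡ (c (suc m)))) (ℤ.+-identityˡ _) ⟩
      conv (Sc ∘ suc) m                              ≡⟨ conv-cong m (λ i j i+j≡m → trans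
        (cong (λ z → z ℤ.* c j) (rec (ℕ.s≤s (subst (i ≤_) i+j≡m (ℕ.m≤m+n i j)))))
        (split (+ i) (c i) (c j))) ⟩
      conv (λ i j → W i j ℤ.+ W i j) m               ≡⟨ conv-+ W W m ⟩
      conv W m ℤ.+ conv W m                          ≡⟨ conv-weighted c² m (λ i j → ℤ.*-comm (c i) (c j)) ⟩
      + m ℤ.* conv c² m                              ≡⟨ cong (ℤ._*_ (+ m)) (c-suc m) ⟨
      + m ℤ.* c (suc m)                              ∎

-- Fractions with integer numerators, and means as single fractions.

fromℚᵘ-homo-+ : ∀ p q → fromℚᵘ p ℚ.+ fromℚᵘ q ≡ fromℚᵘ (p ℚᵘ.+ q)
fromℚᵘ-homo-+ p q = trans (sym (ℚ.fromℚᵘ-toℚᵘ _)) (ℚ.fromℚᵘ-cong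
  (ℚᵘ.≃-trans (ℚ.toℚᵘ-homo-+ (fromℚᵘ p) (fromℚᵘ q))
              (ℚᵘ.+-cong (ℚ.toℚᵘ-fromℚᵘ p) (ℚ.toℚᵘ-fromℚᵘ q))))

fromℚᵘ-homo-* : ∀ p q → fromℚᵘ p ℚ.* fromℚᵘ q ≡ fromℚᵘ (p ℚᵘ.* q)
fromℚᵘ-homo-* p q = trans (sym (ℚ.fromℚᵘ-toℚᵘ _)) (ℚ.fromℚᵘ-cong
  (ℚᵘ.≃-trans (ℚ.toℚᵘ-homo-* (fromℚᵘ p) (fromℚᵘ q))
              (ℚᵘ.*-cong (ℚ.toℚᵘ-fromℚᵘ p) (ℚ.toℚᵘ-fromℚᵘ q))))

fromℚᵘ-homo‿- : ∀ p → ℚ.- fromℚᵘ p ≡ fromℚᵘ (ℚᵘ.- p)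
fromℚᵘ-homo‿- p = trans (sym (ℚ.fromℚᵘ-toℚᵘ _)) (ℚ.fromℚᵘ-cong
  (ℚᵘ.≃-trans (ℚ.toℚᵘ-homo‿- (fromℚᵘ p)) (ℚᵘ.-‿cong (ℚ.toℚᵘ-fromℚᵘ p))))

-- `_/_` reduces to lowest terms. Matching the denominators as `suc` presents both sides as images
-- under `fromℚᵘ`, where cross multiplication decides equality.
/-cross : ∀ a d b e .{{_ : NonZero d}} .{{_ : NonZero e}} → a ℤ.* + e ≡ b ℤ.* + d → a / d ≡ b / e
/-cross a (suc d) b (suc e) eq = ℚ.fromℚᵘ-cong {mkℚᵘ a d} {mkℚᵘ b e} (*≡* eq)

/-homo-+ : ∀ a b d .{{_ : NonZero d}} → a / d ℚ.+ b / d ≡ (a ℤ.+ b) / d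
/-homo-+ a b (suc d) = trans (fromℚᵘ-homo-+ (mkℚᵘ a d) (mkℚᵘ b d))
  (ℚ.fromℚᵘ-cong {mkℚᵘ a d ℚᵘ.+ mkℚᵘ b d} {mkℚᵘ (a ℤ.+ b) d}
    (*≡* (trans (common a b (+ suc d)) (cong (ℤ._*_ (a ℤ.+ b)) (sym (ℤ.pos-* (suc d) (suc d)))))))
  where
  common : ∀ a b d → (a ℤ.* d ℤ.+ b ℤ.* d) ℤ.* d ≡ (a ℤ.+ b) ℤ.* (d ℤ.* d)
  common = solve-∀

/-homo-* : ∀ a d b e .{{_ : NonZero d}} .{{_ : NonZero e}} →
           (a / d) ℚ.* (b / e) ≡ ((a ℤ.* b) / (d * e)) {{ℕ.m*n≢0 d e}}
/-homo-* a (suc d) b (suc e) = fromℚᵘ-homo-* (mkℚᵘ a d) (mkℚᵘ b e)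

∑-/ : (f : A → ℤ) (d : ℕ) .{{_ : NonZero d}} (xs : List A) →
      foldr ℚ._+_ 0ℚ (map (λ x → f x / d) xs) ≡ ∑ f xs / d
∑-/ f d []       = /-cross 0ℤ 1 0ℤ d refl
∑-/ f d (x ∷ xs) = trans (cong (ℚ._+_ (f x / d)) (∑-/ f d xs)) (/-homo-+ (f x) (∑ f xs) d)

mean-/ : (f : A → ℤ) (d : ℕ) .{{_ : NonZero d}} (xs : List A) .{{_ : NonZero (length xs)}} →
         mean (λ x → f x / d) xs ≡ (∑ f xs / (d * length xs)) {{ℕ.m*n≢0 d (length xs)}}
mean-/ f d xs = begin
  mean (λ x → f x / d) xs                        ≡⟨ cong (λ s → s ℚ.* (1ℤ / length xs)) (∑-/ f d xs) ⟩
  (∑ f xs / d) ℚ.* (1ℤ / length xs)              ≡⟨ /-homo-* (∑ f xs) d 1ℤ (length xs) ⟩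
  ((∑ f xs ℤ.* 1ℤ) / (d * length xs)) {{d*len≢0}}
    ≡⟨ cong (λ z → (z / (d * length xs)) {{d*len≢0}}) (ℤ.*-identityʳ (∑ f xs)) ⟩
  (∑ f xs / (d * length xs)) {{d*len≢0}}          ∎
  where
  open ≡-Reasoning
  d*len≢0 : NonZero (d * length xs)
  d*len≢0 = ℕ.m*n≢0 d (length xs)

mean-cong-local : {f g : A → ℚ} (xs : List A) .{{_ : NonZero (length xs)}} →
                  (∀ {x} → x ∈ xs → f x ≡ g x) → mean f xs ≡ mean g xs
mean-cong-local xs f≗g =
  cong (λ ys → foldr ℚ._+_ 0ℚ ys ℚ.* (1ℤ / length xs)) (List.map-cong-local (All.tabulate f≗g))

-- Mean and variance of `J`.

2J≡D+n : ∀ n {t} → t ∈ trees (suc n) → + 2 ℤ.* + J t ≡ D t ℤ.+ + n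
2J≡D+n n {t} t∈ = ∙-cancelʳ 1ℤ _ _ (begin
  -- The added `1ℤ` is `sgn (suc n)`; on the right it cancels the one in `V t = suc n`.
  + 2 ℤ.* + J t ℤ.+ 1ℤ           ≡⟨ cong (λ k → + 2 ℤ.* + J t ℤ.+ sgn k) (∈-trees⁻ {suc n} t t∈) ⟨
  + 2 ℤ.* + J t ℤ.+ sgn (V t)    ≡⟨ 2J≡D+V t ⟩
  D t ℤ.+ + V t                  ≡⟨ cong (λ k → D t ℤ.+ + k) (∈-trees⁻ {suc n} t t∈) ⟩
  D t ℤ.+ (1ℤ ℤ.+ + n)           ≡⟨ move-1 (D t) (+ n) ⟩
  D t ℤ.+ + n ℤ.+ 1ℤ             ∎)
  where
  open ≡-Reasoning
  move-1 : ∀ d n → d ℤ.+ (1ℤ ℤ.+ n) ≡ d ℤ.+ n ℤ.+ 1ℤ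
  move-1 = solve-∀

2∑J≡nc : ∀ n → + 2 ℤ.* ∑ (+_ ∘ J) (trees (suc n)) ≡ c (suc n) ℤ.* + n
2∑J≡nc n = begin
  + 2 ℤ.* ∑ (+_ ∘ J) ts            ≡⟨ ∑-*ˡ (+ 2) (+_ ∘ J) ts ⟨
  ∑ (λ t → + 2 ℤ.* + J t) ts       ≡⟨ ∑-cong-local {xs = ts} (2J≡D+n n) ⟩
  ∑ (λ t → D t ℤ.+ + n) ts         ≡⟨ ∑-+ D (λ _ → + n) ts ⟩
  ∑ D ts ℤ.+ ∑ (λ _ → + n) ts      ≡⟨ cong₂ ℤ._+_ (∑D≡0 (suc n)) (∑-const (+ n) ts) ⟩
  0ℤ ℤ.+ c (suc n) ℤ.* + n         ≡⟨ ℤ.+-identityˡ _ ⟩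
  c (suc n) ℤ.* + n                ∎
  where
  open ≡-Reasoning
  ts : List Tree
  ts = trees (suc n)

mean-J : ∀ n → mean (λ t → + J t / 1) (trees (suc n)) {{trees-nonEmpty (suc n)}} ≡ + n / 2
mean-J n = trans (mean-/ (+_ ∘ J) 1 (trees (suc n)))
  (/-cross (∑ (+_ ∘ J) (trees (suc n))) (1 * len) (+ n) 2 (begin
    ∑ (+_ ∘ J) (trees (suc n)) ℤ.* + 2  ≡⟨ ℤ.*-comm _ (+ 2) ⟩
    + 2 ℤ.* ∑ (+_ ∘ J) (trees (suc n))  ≡⟨ 2∑J≡nc n ⟩
    + len ℤ.* + n                       ≡⟨ ℤ.*-comm (+ len) (+ n) ⟩
    + n ℤ.* + len                       ≡⟨ cong (λ k → + n ℤ.* + k) (ℕ.*-identityˡ len) ⟨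
    + n ℤ.* + (1 * len)                 ∎))
  where
  open ≡-Reasoning
  len : ℕ
  len = length (trees (suc n))
  instance
    len≢0 : NonZero len
    len≢0 = trees-nonEmpty (suc n)
    1*len≢0 : NonZero (1 * len)
    1*len≢0 = ℕ.m*n≢0 1 len

-- Since `J = (D + n) / 2` on these trees and the mean is `n / 2`, only the `D` part remains.
deviation : ∀ n {t} → t ∈ trees (suc n) → + J t / 1 ℚ.- + n / 2 ≡ D t / 2
deviation n {t} t∈ = begin
  + J t / 1 ℚ.- + n / 2                  ≡⟨ cong₂ ℚ._+_ halve (fromℚᵘ-homo‿- (mkℚᵘ (+ n) 1)) ⟩
  (D t ℤ.+ + n) / 2 ℚ.+ (- + n) / 2      ≡⟨ /-homo-+ (D t ℤ.+ + n) (- + n) 2 ⟩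
  (D t ℤ.+ + n ℤ.+ - + n) / 2            ≡⟨ cong (_/ 2) (cancel (D t) (+ n)) ⟩
  D t / 2                                ∎
  where
  open ≡-Reasoning
  cancel : ∀ d n → d ℤ.+ n ℤ.+ - n ≡ d
  cancel = solve-∀
  halve : + J t / 1 ≡ (D t ℤ.+ + n) / 2
  halve = /-cross (+ J t) 1 (D t ℤ.+ + n) 2
    (trans (ℤ.*-comm (+ J t) (+ 2)) (trans (2J≡D+n n t∈) (sym (ℤ.*-identityʳ _))))

-- Each squared deviation is `D² / 4`, which leaves a quarter of the mean of `D²`.
variance-J : ∀ n → variance (λ t → + J t / 1) (trees (suc n)) {{trees-nonEmpty (suc n)}} ≡
             (S (suc n) / (4 * length (trees (suc n))))
               {{ℕ.m*n≢0 4 (length (trees (suc n))) {{_}} {{trees-nonEmpty (suc n)}}}}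
variance-J n = trans (mean-cong-local (trees (suc n)) squared) (mean-/ (sq ∘ D) 4 (trees (suc n)))
  where
  instance
    len≢0 : NonZero (length (trees (suc n)))
    len≢0 = trees-nonEmpty (suc n)
  μ : ℚ
  μ = mean (λ t → + J t / 1) (trees (suc n))
  squared : ∀ {t} → t ∈ trees (suc n) → (+ J t / 1 ℚ.- μ) ℚ.* (+ J t / 1 ℚ.- μ) ≡ sq (D t) / 4
  squared {t} t∈ = trans (cong (λ x → x ℚ.* x) dev) (/-homo-* (D t) 2 (D t) 2)
    where
    dev : + J t / 1 ℚ.- μ ≡ D t / 2
    dev = trans (cong (ℚ._-_ (+ J t / 1)) (mean-J n)) (deviation n t∈)

8n∸4 : ∀ n → 8 * suc n ∸ 4 ≡ 4 ℕ.+ 8 * n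
8n∸4 n = cong (_∸ 4) (ℕ.*-suc 8 n)

-- In outline, `2 n c n (8 n + 4) = 4 n (4 n + 2) c n = 4 n (n + 2) c (n + 1)`, and `n (n + 2) = (n
-- + 1)² - 1`.
cross-multiplied : ∀ n → S (suc n) ℤ.* + (8 * suc n ∸ 4) ≡
                         (+ (suc n ^ 2) - 1ℤ) ℤ.* + (4 * length (trees (suc n)))
cross-multiplied n = begin
  S (suc n) ℤ.* + (8 * suc n ∸ 4)
    ≡⟨ cong₂ ℤ._*_ (S≡2nc n) (trans (cong +_ (8n∸4 n)) (cong (ℤ._+_ (+ 4)) (ℤ.pos-* 8 n))) ⟩
  + 2 ℤ.* + n ℤ.* c n ℤ.* (+ 4 ℤ.+ + 8 ℤ.* + n)
    ≡⟨ factor (+ n) (c n) ⟩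
  + 4 ℤ.* + n ℤ.* ((+ 4 ℤ.* + n ℤ.+ + 2) ℤ.* c n)
    ≡⟨ cong (ℤ._*_ (+ 4 ℤ.* + n)) (c-ratio n) ⟨
  + 4 ℤ.* + n ℤ.* ((+ n ℤ.+ + 2) ℤ.* c (suc n))
    ≡⟨ unfactor (+ n) (c (suc n)) ⟩
  ((1ℤ ℤ.+ + n) ℤ.* ((1ℤ ℤ.+ + n) ℤ.* 1ℤ) - 1ℤ) ℤ.* (+ 4 ℤ.* c (suc n))
    ≡⟨ cong₂ (λ a b → (a - 1ℤ) ℤ.* b)
             (trans (ℤ.pos-* (suc n) (suc n * 1)) (cong (ℤ._*_ (+ suc n)) (ℤ.pos-* (suc n) 1)))
             (ℤ.pos-* 4 (length (trees (suc n)))) ⟨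
  (+ (suc n ^ 2) - 1ℤ) ℤ.* + (4 * length (trees (suc n)))
    ∎
  where
  open ≡-Reasoning
  factor : ∀ n k → + 2 ℤ.* n ℤ.* k ℤ.* (+ 4 ℤ.+ + 8 ℤ.* n) ≡
                   + 4 ℤ.* n ℤ.* ((+ 4 ℤ.* n ℤ.+ + 2) ℤ.* k)
  factor = solve-∀
  -- The trailing factor `1ℤ` mirrors the unfolding of `suc n ^ 2` to `suc n * (suc n * 1)`.
  unfactor : ∀ n k → + 4 ℤ.* n ℤ.* ((n ℤ.+ + 2) ℤ.* k) ≡
                     ((1ℤ ℤ.+ n) ℤ.* ((1ℤ ℤ.+ n) ℤ.* 1ℤ) - 1ℤ) ℤ.* (+ 4 ℤ.* k)
  unfactor = solve-∀

theorem7p2 : (n : ℕ) → .{{_ : NonZero n}} →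
    variance (λ t → + J t / 1) (trees n) {{trees-nonEmpty n}}
    ≡ ((+ (n ^ 2) - + 1) / (8 * n ∸ 4)) {{8n∸4-nonZero n}}
theorem7p2 (suc n) = trans (variance-J n)
  (/-cross (S (suc n)) (4 * length (trees (suc n))) (+ (suc n ^ 2) - + 1) (8 * suc n ∸ 4)
    {{ℕ.m*n≢0 4 (length (trees (suc n))) {{_}} {{trees-nonEmpty (suc n)}}}} {{8n∸4-nonZero (suc n)}}
    (cross-multiplied n))
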